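{- For all integers $n \geq 0$, $$b_{4,2}(n) \geq b_{3,2}(n),$$ where $b_{t,k}(n)$ denotes the total number of hooks of length $k$ in all the $t$-regular partitions of $n$.
   Context: A partition $\lambda$ of a positive integer $n$ is a finite sequence of positive integers $\lambda=(\lambda_1,\lambda_2,\ldots,\lambda_r)$ with $\lambda_1\geq\lambda_2\geq\cdots\geq\lambda_r$ and $\sum_{i=1}^r\lambda_i=n$; the $\lambda_i$ are its parts. For $n=0$ the only partition is the empty partition, which has no hooks. For an integer $t\geq 2$, a $t$-regular partition of $n$ is a partition of $n$ none of whose parts is divisible by $t$. The Young diagram of $(\lambda_1,\ldots,\lambda_r)$ is the left-justified array of boxes whose $i$-th row from the top contains $\lambda_i$ boxes. The hook length of a box in a Young diagram is the number of boxes directly to its right (in the same row), plus the number of boxes directly below it (in the same column), plus $1$ (for the box itself). A hook of length $k$ in a partition corresponds to a box of its Young diagram with hook length $k$. For integers $t\geq 2$ and $k\geq 1$, $b_{t,k}(n)$ denotes the number of hooks of length $k$ in all the $t$-regular partitions of $n$, that is, the sum over all $t$-regular partitions $\lambda$ of $n$ of the number of boxes in the Young diagram of $\lambda$ having hook length exactly $k$. -}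

module Defs where

open import Data.Nat
open import Data.Nat.Divisibility using (_∤_; _∣?_)
open import Data.Nat.ListAction using (sum)
open import Data.Nat.Properties
open import Data.List using (List; []; _∷_; _++_; map; concatMap; filter; length; upTo)
open import Data.List.Membership.Propositional using (_∈_; find; lose)
open import Data.List.Membership.Propositional.Properties
open import Data.List.Relation.Binary.Disjoint.Propositional using (Disjoint)
open import Data.List.Relation.Unary.All using (All; []; _∷_; all?; universal)
import Data.List.Relation.Unary.All.Properties as All
open import Data.List.Relation.Unary.AllPairs as AllPairs using ([]; _∷_)
import Data.List.Relation.Unary.AllPairs.Properties as AllPairs
open import Data.List.Relation.Unary.Any using (here)
open import Data.List.Relation.Unary.Linked using (Linked; []; [-]; _∷_)
import Data.List.Relation.Unary.Linked as Linked
open import Data.List.Relation.Unary.Unique.Propositional using (Unique)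
import Data.List.Relation.Unary.Unique.Propositional.Properties as Unique
open import Data.List.Properties using (∷-injectiveˡ; ∷-injectiveʳ)
open import Data.Product using (_×_; _,_)
open import Function using (_⇔_; mk⇔)
open import Relation.Binary.PropositionalEquality
open import Relation.Nullary using (Dec; ¬?)

record IsPartition (n : ℕ) (xs : List ℕ) : Set where
  field
    decreasing : Linked _≥_ xs
    positive   : All (0 <_) xs
    total      : sum xs ≡ n

Regular : ℕ → List ℕ → Set
Regular t = All (t ∤_)

regular? : ∀ t xs → Dec (Regular t xs)
regular? t = all? (λ x → ¬? (t ∣? x))

-- The partitions of n with all parts at most m, provided that the recursion
-- bound f is at least n.
boundedPartitions : (f m n : ℕ) → List (List ℕ)
boundedPartitions f       m zero    = [] ∷ []
boundedPartitions zero    m (suc n) = []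
boundedPartitions (suc f) m (suc n) =
  concatMap (λ x → map (suc x ∷_) (boundedPartitions f (suc x) (n ∸ x)))
            (upTo (m ⊓ suc n))

-- Each partition of n occurs exactly once: see ∈-partitions and
-- partitions-unique below.
partitions : ℕ → List (List ℕ)
partitions n = boundedPartitions n n n

regularPartitions : ℕ → ℕ → List (List ℕ)
regularPartitions t n = filter (regular? t) (partitions n)

-- For a box in column j (counted from 0) of a row of length x, with xs the
-- rows below that row: x ∸ suc j boxes lie to its right, and each row of xs
-- of length greater than j contributes one box below it.
hookLength : (x : ℕ) (xs : List ℕ) (j : ℕ) → ℕ
hookLength x xs j = (x ∸ suc j) + length (filter (j <?_) xs) + 1

-- One entry for each box of the Young diagram with the given row lengths.
hookLengths : List ℕ → List ℕ
hookLengths []       = []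
hookLengths (x ∷ xs) = map (hookLength x xs) (upTo x) ++ hookLengths xs

hookCount : ℕ → List ℕ → ℕ
hookCount k xs = length (filter (_≟ k) (hookLengths xs))

b : (t k n : ℕ) → ℕ
b t k n = sum (map (hookCount k) (regularPartitions t n))

private
  sound : ∀ f m n {xs} → xs ∈ boundedPartitions f m n →
          Linked _≥_ (m ∷ xs) × All (0 <_) xs × sum xs ≡ n
  sound f       m zero    (here refl) = [-] , [] , refl
  sound zero    m (suc n) ()
  sound (suc f) m (suc n) p
    with x , x∈ , q ← find (∈-concatMap⁻
      (λ x → map (suc x ∷_) (boundedPartitions f (suc x) (n ∸ x)))
      {xs = upTo (m ⊓ suc n)} p)
    with ys , ys∈ , refl ← ∈-map⁻ (suc x ∷_) q
    with dec , pos , tot ← sound f (suc x) (n ∸ x) ys∈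
    = ≤-trans (∈-upTo⁻ x∈) (m⊓n≤m m (suc n)) ∷ dec
    , z<s ∷ pos
    , cong suc (trans (cong (x +_) tot)
        (m+[n∸m]≡n (s≤s⁻¹ (≤-trans (∈-upTo⁻ x∈) (m⊓n≤n m (suc n))))))

  complete : ∀ f m {xs} n → n ≤ f → Linked _≥_ (m ∷ xs) → All (0 <_) xs →
             sum xs ≡ n → xs ∈ boundedPartitions f m n
  complete zero    m {[]} zero n≤f dec pos tot = here refl
  complete (suc f) m {[]} zero n≤f dec pos tot = here refl
  complete f m {zero ∷ xs} n n≤f dec (() ∷ pos) tot
  complete f m {suc x ∷ xs} zero n≤f dec pos ()
  complete (suc f) m {suc x ∷ xs} (suc n) (s≤s n≤f) (x<m ∷ dec) (_ ∷ pos) refl =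
    ∈-concatMap⁺ _ (lose
      (∈-upTo⁺ (⊓-glb x<m (s≤s (m≤m+n x (sum xs)))))
      (∈-map⁺ (suc x ∷_)
        (complete f (suc x) (n ∸ x) (≤-trans (m∸n≤m n x) n≤f) dec pos
          (sym (m+n∸m≡n x (sum xs))))))

  unique : ∀ f m n → Unique (boundedPartitions f m n)
  unique f       m zero    = [] ∷ []
  unique zero    m (suc n) = []
  unique (suc f) m (suc n) = Unique.concat⁺
    (All.map⁺ (universal
      (λ x → Unique.map⁺ ∷-injectiveʳ (unique f (suc x) (n ∸ x))) _))
    (AllPairs.map⁺ (AllPairs.map disjoint (Unique.upTo⁺ (m ⊓ suc n))))
    where
    disjoint : ∀ {x y} {xss yss : List (List ℕ)} → x ≢ y →
               Disjoint (map (suc x ∷_) xss) (map (suc y ∷_) yss)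
    disjoint x≢y (p , q)
      with _ , _ , refl ← ∈-map⁻ _ p
      with _ , _ , eq ← ∈-map⁻ _ q
      = x≢y (suc-injective (∷-injectiveˡ eq))

∈-partitions : ∀ n xs → xs ∈ partitions n ⇔ IsPartition n xs
∈-partitions n xs = mk⇔ to from
  where
  to : xs ∈ partitions n → IsPartition n xs
  to p with dec , pos , tot ← sound n n n p = record
    { decreasing = Linked.tail dec ; positive = pos ; total = tot }

  bounded : ∀ {ys} → Linked _≥_ ys → sum ys ≡ n → Linked _≥_ (n ∷ ys)
  bounded {[]}     dec tot  = [-]
  bounded {y ∷ ys} dec refl = m≤m+n y (sum ys) ∷ dec

  from : IsPartition n xs → xs ∈ partitions n
  from p = complete n n n ≤-refl (bounded decreasing total) positive total
    where open IsPartition p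

partitions-unique : ∀ n → Unique (partitions n)
partitions-unique n = unique n n n

module Submission where

-- Let B_t be the generating function of the t-regular partitions.  A box of
-- hook length 2 has either one box to its right and none below it, or none to
-- its right and one below it.  So a partition has one such box for every part
-- size x at least 2 such that x - 1 is not a part, and one for every part size
-- that occurs at least twice.  Hence the generating function of b t 2 is
-- B_t G_t, where
--
--   G_t = sum of q^x + q^(2x) over the x not divisible by t
--         - q - sum of q^(2x-1) over the x at least 2 with neither x nor x - 1
--         divisible by t.
--
-- This is proved (closed-∤) by induction on a bound for the parts, from the
-- recurrences for regulars and hooks, the counts of regular partitions and of
-- their hooks of length 2.  To avoid subtraction, the negative terms stand on
-- the other side of the equation.
--
-- The exponents that occur in G_3 and G_4 form arithmetic progressions whose
-- steps divide 24, so with W_t = B_t / (1 - q^24) each product B_t G_t becomes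
-- a polynomial multiple of W_t (closed-residues):
--
--   B_4 G_4 = g W_4   and   B_3 G_3 + l W_3 = r W_3,
--
-- where g, l and r have nonnegative coefficients (gain₄, lhs₃, rhs₃).  The
-- inequality follows from two facts.
--
-- First, B_3 is at most B_4 coefficientwise (regulars-mono), hence g W_3 is at
-- most g W_4.  By Glaisher's theorem the t-regular partitions of n are as
-- numerous as the partitions of n with each part repeated less than t times,
-- and the number of the latter is nondecreasing in t.
--
-- Second, r W_3 is at most (g + l) W_3 (gain-dominates).  The parts 1 and 2 are
-- allowed in a 3-regular partition, so W_3 is a multiple of
-- 1 / ((1 - q)(1 - q^2)).  This makes its coefficients nondecreasing, so that
-- q^y W_3 is at most q^x W_3 for x at most y, and it makes the product of W_3
-- and 1 - q - q^2 + q^3 nonnegative.  Finitely many comparisons of these two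
-- kinds turn r into g + l.

open import Defs
open import Data.Nat
open import Data.Nat.Properties
open import Data.Nat.Divisibility
open import Data.Nat.Induction using (<-rec)
open import Data.Nat.ListAction using (sum)
open import Data.Nat.ListAction.Properties using (sum-++)
open import Data.Nat.Tactic.RingSolver using (solve-∀)
open import Data.List using
    (List; []; _∷_; _++_; _∷ʳ_; map; concat; concatMap; filter; length; upTo)
open import Data.List.Properties hiding (sum-++)
open import Data.List.Relation.Binary.Permutation.Propositional as Perm
  using (_↭_; prep; swap; ↭-reflexive; ↭-sym; ↭-trans)
open import Data.List.Relation.Binary.Pointwise as Pointwise using (Pointwise; []; _∷_)
open import Data.List.Relation.Unary.All as All using (All; []; _∷_)
import Data.List.Relation.Unary.All.Properties as All
open import Data.List.Sort.InsertionSort.Base ≤-decTotalOrder using (sort)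
open import Data.List.Sort.InsertionSort.Properties ≤-decTotalOrder using (sort-↭)
open import Data.Empty using (⊥-elim)
open import Data.Product using (∃; _,_)
open import Data.Sum using (inj₁; inj₂)
open import Function using (_∘_; const)
open import Relation.Binary.PropositionalEquality
open import Relation.Nullary using (Dec; yes; no; ¬_)
open import Relation.Nullary.Decidable using (from-yes)

-- Formal power series

-- A power series with coefficients in ℕ; q denotes its variable.
Seq : Set
Seq = ℕ → ℕ

infixl 6 _⊕_
_⊕_ : Seq → Seq → Seq
(f ⊕ g) n = f n + g n

𝟘 : Seq
𝟘 _ = 0

-- Coefficientwise comparison.
infix 4 _≼_
_≼_ : Seq → Seq → Set
f ≼ g = ∀ n → f n ≤ g n

-- S x f is q^x f.
S : ℕ → Seq → Seq
S zero    f n       = f n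
S (suc x) f zero    = 0
S (suc x) f (suc n) = S x f n

S-local : ∀ x {f g} n → (∀ {k} → x + k ≡ n → f k ≡ g k) → S x f n ≡ S x g n
S-local zero    n       eq = eq refl
S-local (suc x) zero    eq = refl
S-local (suc x) (suc n) eq = S-local x n (λ p → eq (cong suc p))

S-cong : ∀ x {f g} → f ≗ g → S x f ≗ S x g
S-cong x eq n = S-local x n (λ {k} _ → eq k)

S-local< : ∀ x .{{_ : NonZero x}} {f g} n → (∀ {k} → k < n → f k ≡ g k) →
           S x f n ≡ S x g n
S-local< (suc x) n eq = S-local (suc x) n
  (λ { {k} refl → eq (s≤s (m≤n+m k x)) })

S-⊕ : ∀ x f g → S x (f ⊕ g) ≗ S x f ⊕ S x g
S-⊕ zero    f g n       = refl
S-⊕ (suc x) f g zero    = refl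
S-⊕ (suc x) f g (suc n) = S-⊕ x f g n

S-𝟘 : ∀ x → S x 𝟘 ≗ 𝟘
S-𝟘 zero    n       = refl
S-𝟘 (suc x) zero    = refl
S-𝟘 (suc x) (suc n) = S-𝟘 x n

S-S : ∀ x y f → S x (S y f) ≗ S (x + y) f
S-S zero    y f n       = refl
S-S (suc x) y f zero    = refl
S-S (suc x) y f (suc n) = S-S x y f n

S-swap : ∀ x y f → S x (S y f) ≗ S y (S x f)
S-swap x y f n = trans (S-S x y f n)
  (trans (cong (λ z → S z f n) (+-comm x y)) (sym (S-S y x f n)))

S-mono≤ : ∀ x {f g} N → (∀ {k} → k ≤ N → f k ≤ g k) → ∀ {n} → n ≤ N → S x f n ≤ S x g n
S-mono≤ zero    N le n≤N = le n≤N
S-mono≤ (suc x) N le {zero}  n≤N = z≤n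
S-mono≤ (suc x) N le {suc n} n≤N = S-mono≤ x N le (<⇒≤ n≤N)

S-mono : ∀ x {f g} → f ≼ g → S x f ≼ S x g
S-mono x le n = S-mono≤ x n (λ {k} _ → le k) ≤-refl

S-< : ∀ {x n} f → n < x → S x f n ≡ 0
S-< {suc x} {zero}  f lt = refl
S-< {suc x} {suc n} f lt = S-< f (s<s⁻¹ lt)

S-≤ : ∀ {x n} f → x ≤ n → S x f n ≡ f (n ∸ x)
S-≤ {zero}  {n}     f le = refl
S-≤ {suc x} {suc n} f le = S-≤ f (s≤s⁻¹ le)

-- M t x f is (1 + q^x + ... + q^((t-1)x)) f, the generating function for at most
-- t - 1 further parts of size x.
M : ℕ → ℕ → Seq → Seq
M zero    x f = 𝟘
M (suc t) x f = f ⊕ S x (M t x f)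

-- P x f is f / (1 - q^x), the generating function for any number of further
-- parts of size x.  For x at least 1, the first n + 1 terms of the geometric
-- series determine the coefficient at n.
P : ℕ → Seq → Seq
P x f n = M (suc n) x f n

M-stable-suc : ∀ x .{{_ : NonZero x}} f {t k} → k < t → M (suc t) x f k ≡ M t x f k
M-stable-suc x f {suc t} {k} k<t =
  cong (f k +_) (S-local< x k (λ j<k → M-stable-suc x f (<-≤-trans j<k (s≤s⁻¹ k<t))))

M-stable : ∀ x .{{_ : NonZero x}} f {t k} → k < t → M t x f k ≡ P x f k
M-stable x f {suc t} {k} k<t with m≤n⇒m<n∨m≡n (s≤s⁻¹ k<t)
... | inj₁ k<t′ = trans (M-stable-suc x f k<t′) (M-stable x f k<t′)
... | inj₂ refl = refl

P-fix : ∀ x .{{_ : NonZero x}} f → P x f ≗ f ⊕ S x (P x f)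
P-fix x f n = cong (f n +_) (S-local< x n (M-stable x f))

-- Up to degree N, a solution of f = a + q^x f is determined by a up to degree N.
-- Identities between the series P x f are proved by this uniqueness.
fix-unique≤ : ∀ x .{{_ : NonZero x}} {a b f g} N → (∀ {k} → k ≤ N → a k ≡ b k) →
  f ≗ a ⊕ S x f → g ≗ b ⊕ S x g → ∀ {n} → n ≤ N → f n ≡ g n
fix-unique≤ x {a} {b} {f} {g} N a≡b p q {n} = <-rec (λ n → n ≤ N → f n ≡ g n) step n
  where
  step : ∀ n → (∀ {k} → k < n → k ≤ N → f k ≡ g k) → n ≤ N → f n ≡ g n
  step n rec n≤N = trans (p n) (trans
    (cong₂ _+_ (a≡b n≤N) (S-local< x n (λ k<n → rec k<n (≤-trans (<⇒≤ k<n) n≤N))))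
    (sym (q n)))

fix-unique : ∀ x .{{_ : NonZero x}} {a f g} →
  f ≗ a ⊕ S x f → g ≗ a ⊕ S x g → f ≗ g
fix-unique x p q n = fix-unique≤ x n (λ _ → refl) p q ≤-refl

P-unique : ∀ x .{{_ : NonZero x}} {f g} → g ≗ f ⊕ S x g → g ≗ P x f
P-unique x {f} p = fix-unique x p (P-fix x f)

P-cong≤ : ∀ x .{{_ : NonZero x}} {f g} N → (∀ {k} → k ≤ N → f k ≡ g k) →
          ∀ {n} → n ≤ N → P x f n ≡ P x g n
P-cong≤ x {f} {g} N eq = fix-unique≤ x N eq (P-fix x f) (P-fix x g)

P-cong : ∀ x .{{_ : NonZero x}} {f g} → f ≗ g → P x f ≗ P x g
P-cong x eq n = P-cong≤ x n (λ {k} _ → eq k) ≤-refl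

P-injective≤ : ∀ x .{{_ : NonZero x}} {f g} N → (∀ {k} → k ≤ N → P x f k ≡ P x g k) →
               ∀ {n} → n ≤ N → f n ≡ g n
P-injective≤ x {f} {g} N eq {n} n≤N = +-cancelʳ-≡ (S x (P x g) n) (f n) (g n) (begin
  f n + S x (P x g) n ≡⟨ cong (f n +_) (S-local< x n (λ k<n → eq (≤-trans (<⇒≤ k<n) n≤N))) ⟨
  f n + S x (P x f) n ≡⟨ P-fix x f n ⟨
  P x f n             ≡⟨ eq n≤N ⟩
  P x g n             ≡⟨ P-fix x g n ⟩
  g n + S x (P x g) n ∎)
  where open ≡-Reasoning

interchange : ∀ a b c d → (a + b) + (c + d) ≡ (a + c) + (b + d)
interchange = solve-∀

P-⊕ : ∀ x .{{_ : NonZero x}} f g → P x (f ⊕ g) ≗ P x f ⊕ P x g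
P-⊕ x f g n = sym (P-unique x {f ⊕ g} {P x f ⊕ P x g} eq n)
  where
  eq : P x f ⊕ P x g ≗ f ⊕ g ⊕ S x (P x f ⊕ P x g)
  eq n = begin
    P x f n + P x g n                                  ≡⟨ cong₂ _+_ (P-fix x f n) (P-fix x g n) ⟩
    (f n + S x (P x f) n) + (g n + S x (P x g) n)      ≡⟨ interchange (f n) _ (g n) _ ⟩
    (f n + g n) + (S x (P x f) n + S x (P x g) n)
        ≡⟨ cong (f n + g n +_) (S-⊕ x (P x f) (P x g) n) ⟨
    (f n + g n) + S x (P x f ⊕ P x g) n                ∎
    where open ≡-Reasoning

P-S : ∀ x .{{_ : NonZero x}} y f → P x (S y f) ≗ S y (P x f)
P-S x y f n = sym (P-unique x {S y f} {S y (P x f)} eq n)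
  where
  eq : S y (P x f) ≗ S y f ⊕ S x (S y (P x f))
  eq n = begin
    S y (P x f) n                        ≡⟨ S-cong y (P-fix x f) n ⟩
    S y (f ⊕ S x (P x f)) n              ≡⟨ S-⊕ y f (S x (P x f)) n ⟩
    S y f n + S y (S x (P x f)) n        ≡⟨ cong (S y f n +_) (S-swap y x (P x f) n) ⟩
    S y f n + S x (S y (P x f)) n        ∎
    where open ≡-Reasoning

P-P : ∀ x .{{_ : NonZero x}} y .{{_ : NonZero y}} f → P x (P y f) ≗ P y (P x f)
P-P x y f = P-unique y eq
  where
  eq : P x (P y f) ≗ P x f ⊕ S y (P x (P y f))
  eq n = begin
    P x (P y f) n                       ≡⟨ P-cong x (P-fix y f) n ⟩
    P x (f ⊕ S y (P y f)) n             ≡⟨ P-⊕ x f (S y (P y f)) n ⟩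
    P x f n + P x (S y (P y f)) n       ≡⟨ cong (P x f n +_) (P-S x y (P y f) n) ⟩
    P x f n + S y (P x (P y f)) n       ∎
    where open ≡-Reasoning

M-mono≤ : ∀ t x {f g} N → (∀ {k} → k ≤ N → f k ≤ g k) → ∀ {n} → n ≤ N → M t x f n ≤ M t x g n
M-mono≤ zero    x N le n≤N = z≤n
M-mono≤ (suc t) x N le n≤N = +-mono-≤ (le n≤N) (S-mono≤ x N (M-mono≤ t x N le) n≤N)

M-suc-≼ : ∀ t x f → M t x f ≼ M (suc t) x f
M-suc-≼ zero    x f n = z≤n
M-suc-≼ (suc t) x f n = +-monoʳ-≤ (f n) (S-mono x (M-suc-≼ t x f) n)

P-𝟘 : ∀ x .{{_ : NonZero x}} → P x 𝟘 ≗ 𝟘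
P-𝟘 x n = sym (P-unique x {𝟘} {𝟘} (λ n → sym (S-𝟘 x n)) n)

P-M : ∀ x .{{_ : NonZero x}} t y f → P x (M t y f) ≗ M t y (P x f)
P-M x zero    y f = P-𝟘 x
P-M x (suc t) y f n = trans (P-⊕ x f (S y (M t y f)) n)
  (cong (P x f n +_) (trans (P-S x y (M t y f) n) (S-cong y (P-M x t y f) n)))

-- The finite geometric sum: f / (1 - q^x) is its first t terms plus the rest.
M-P : ∀ t x .{{_ : NonZero x}} f → P x f ≗ M t x f ⊕ S (t * x) (P x f)
M-P zero    x f n = refl
M-P (suc t) x f n = begin
  P x f n                                                ≡⟨ P-fix x f n ⟩
  f n + S x (P x f) n
      ≡⟨ cong (f n +_) (S-cong x (M-P t x f) n) ⟩
  f n + S x (M t x f ⊕ S (t * x) (P x f)) n              ≡⟨ cong (f n +_) (S-⊕ x (M t x f) _ n) ⟩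
  f n + (S x (M t x f) n + S x (S (t * x) (P x f)) n)    ≡⟨ +-assoc (f n) _ _ ⟨
  f n + S x (M t x f) n + S x (S (t * x) (P x f)) n
      ≡⟨ cong (f n + S x (M t x f) n +_) (S-S x (t * x) (P x f) n) ⟩
  f n + S x (M t x f) n + S (suc t * x) (P x f) n        ∎
  where open ≡-Reasoning

-- 1 / (1 - q^(tx)) times 1 + q^x + ... + q^((t-1)x) is 1 / (1 - q^x).
P-of-M : ∀ t x .{{_ : NonZero x}} .{{_ : NonZero (t * x)}} f → P (t * x) (M t x f) ≗ P x f
P-of-M t x f n = sym (P-unique (t * x) (M-P t x f) n)

-- Partitions with bounded parts

-- The recursion bound is irrelevant once it is at least n.
parts-fuel : ∀ {f g} m n → n ≤ f → n ≤ g →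
             boundedPartitions f m n ≡ boundedPartitions g m n
parts-fuel m zero _ _ = refl
parts-fuel m (suc n) (s≤s n≤f) (s≤s n≤g) = concatMap-cong
  (λ x → cong (map (suc x ∷_)) (parts-fuel (suc x) (n ∸ x)
    (≤-trans (m∸n≤m n x) n≤f) (≤-trans (m∸n≤m n x) n≤g)))
  (upTo (m ⊓ suc n))

-- The partitions of n into parts at most m.
parts : ℕ → ℕ → List (List ℕ)
parts m n = boundedPartitions n m n

concatMap-∷ʳ : ∀ {A B : Set} (h : A → List B) xs x →
               concatMap h (xs ∷ʳ x) ≡ concatMap h xs ++ h x
concatMap-∷ʳ h xs x = begin
  concat (map h (xs ∷ʳ x))           ≡⟨ cong concat (map-++ h xs (x ∷ [])) ⟩
  concat (map h xs ++ (h x ∷ []))    ≡⟨ concat-++ (map h xs) (h x ∷ []) ⟨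
  concatMap h xs ++ (h x ++ [])      ≡⟨ cong (concatMap h xs ++_) (++-identityʳ (h x)) ⟩
  concatMap h xs ++ h x              ∎
  where open ≡-Reasoning

parts-small : ∀ m n → n < suc m → parts (suc m) n ≡ parts m n
parts-small m zero    lt = refl
parts-small m (suc n) (s≤s n<m) = cong
  (λ k → concatMap (λ x → map (suc x ∷_) (boundedPartitions n (suc x) (n ∸ x))) (upTo k))
  (trans (m≥n⇒m⊓n≡n (≤-trans n<m (n≤1+n m))) (sym (m≥n⇒m⊓n≡n n<m)))

-- Either suc m does not occur, or the first part is suc m.
parts-large : ∀ m n → suc m ≤ n →
  parts (suc m) n ≡ parts m n ++ map (suc m ∷_) (parts (suc m) (n ∸ suc m))
parts-large m (suc n) (s≤s m≤n) = begin
  concatMap h (upTo (suc (m ⊓ n)))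
      ≡⟨ cong (λ k → concatMap h (upTo (suc k))) (m≤n⇒m⊓n≡m m≤n) ⟩
  concatMap h (upTo (suc m))           ≡⟨ cong (concatMap h) (upTo-∷ʳ m) ⟨
  concatMap h (upTo m ∷ʳ m)            ≡⟨ concatMap-∷ʳ h (upTo m) m ⟩
  concatMap h (upTo m) ++ h m          ≡⟨ cong₂ (λ k l → concatMap h (upTo k) ++ map (suc m ∷_) l)
                                            (sym (m≤n⇒m⊓n≡m (≤-trans m≤n (n≤1+n n))))
                                            (parts-fuel (suc m) (n ∸ m) (m∸n≤m n m) ≤-refl) ⟩
  concatMap h (upTo (m ⊓ suc n)) ++ map (suc m ∷_) (parts (suc m) (n ∸ m)) ∎
  where
  open ≡-Reasoning
  h : ℕ → List (List ℕ)
  h x = map (suc x ∷_) (boundedPartitions n (suc x) (n ∸ x))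

parts-bounded : ∀ f m n → All (All (_≤ m)) (boundedPartitions f m n)
parts-bounded f       m zero    = [] ∷ []
parts-bounded zero    m (suc n) = []
parts-bounded (suc f) m (suc n) = All.concat⁺ (All.map⁺
  (All.map (λ {x} x<k → let x<m = ≤-trans x<k (m⊓n≤m m (suc n)) in
      All.map⁺ (All.map (λ ys≤ → x<m ∷ All.map (λ y≤ → ≤-trans y≤ x<m) ys≤)
                        (parts-bounded f (suc x) (n ∸ x))))
    (All.all-upTo (m ⊓ suc n))))

-- A statistic on partitions.
Weight : Set
Weight = List ℕ → ℕ

-- The sum of φ over the t-regular partitions of n into parts at most m, as a
-- power series in n.
total : ℕ → Weight → ℕ → Seq
total t φ m n = sum (map φ (filter (regular? t) (parts m n)))

sum-map-cong : ∀ {φ ψ : Weight} {xs} → All (λ x → φ x ≡ ψ x) xs → sum (map φ xs) ≡ sum (map ψ xs)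
sum-map-cong eq = cong sum (map-cong-local eq)

module _ (t : ℕ) where

  total-cong : ∀ m {φ ψ} → (∀ {xs} → All (_≤ m) xs → φ xs ≡ ψ xs) → total t φ m ≗ total t ψ m
  total-cong m eq n = sum-map-cong
    (All.map eq (All.filter⁺ (regular? t) (parts-bounded n m n)))

  total-⊕ : ∀ m φ ψ → total t (λ xs → φ xs + ψ xs) m ≗ total t φ m ⊕ total t ψ m
  total-⊕ m φ ψ n = go (filter (regular? t) (parts m n))
    where
    go : ∀ xss → sum (map (λ xs → φ xs + ψ xs) xss) ≡ sum (map φ xss) + sum (map ψ xss)
    go []         = refl
    go (xs ∷ xss) = trans (cong (φ xs + ψ xs +_) (go xss)) (interchange (φ xs) (ψ xs) _ _)

  total-𝟘 : ∀ m → total t (const 0) m ≗ 𝟘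
  total-𝟘 m n = go (filter (regular? t) (parts m n))
    where
    go : ∀ xss → sum (map (const 0) xss) ≡ 0
    go []         = refl
    go (xs ∷ xss) = go xss

  filter-∤ : ∀ {x} → ¬ t ∣ x → ∀ xss →
    filter (regular? t) (map (x ∷_) xss) ≡ map (x ∷_) (filter (regular? t) xss)
  filter-∤ t∤x [] = refl
  filter-∤ {x} t∤x (xs ∷ xss) = by-cases (regular? t xs)
    where
    by-cases : Dec (Regular t xs) → filter (regular? t) (map (x ∷_) (xs ∷ xss)) ≡
               map (x ∷_) (filter (regular? t) (xs ∷ xss))
    by-cases (yes r) = begin
      filter (regular? t) (map (x ∷_) (xs ∷ xss))   ≡⟨ filter-accept (regular? t) (t∤x ∷ r) ⟩
      (x ∷ xs) ∷ filter (regular? t) (map (x ∷_) xss) ≡⟨ cong (_ ∷_) (filter-∤ t∤x xss) ⟩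
      map (x ∷_) (xs ∷ filter (regular? t) xss)
          ≡⟨ cong (map (x ∷_)) (filter-accept (regular? t) r) ⟨
      map (x ∷_) (filter (regular? t) (xs ∷ xss))   ∎
      where open ≡-Reasoning
    by-cases (no ¬r) = begin
      filter (regular? t) (map (x ∷_) (xs ∷ xss))
          ≡⟨ filter-reject (regular? t) {x ∷ xs} (λ { (_ ∷ r) → ¬r r }) ⟩
      filter (regular? t) (map (x ∷_) xss)          ≡⟨ filter-∤ t∤x xss ⟩
      map (x ∷_) (filter (regular? t) xss)
          ≡⟨ cong (map (x ∷_)) (filter-reject (regular? t) ¬r) ⟨
      map (x ∷_) (filter (regular? t) (xs ∷ xss))   ∎
      where open ≡-Reasoning

  filter-∣ : ∀ {x} → t ∣ x → ∀ xss → filter (regular? t) (map (x ∷_) xss) ≡ []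
  filter-∣ t∣x [] = refl
  filter-∣ {x} t∣x (xs ∷ xss) =
    trans (filter-reject (regular? t) {x ∷ xs} (λ { (t∤x ∷ _) → t∤x t∣x })) (filter-∣ t∣x xss)

  total-++ : ∀ φ xss yss → sum (map φ (filter (regular? t) (xss ++ yss))) ≡
    sum (map φ (filter (regular? t) xss)) + sum (map φ (filter (regular? t) yss))
  total-++ φ xss yss = begin
    sum (map φ (filter (regular? t) (xss ++ yss)))
        ≡⟨ cong (sum ∘ map φ) (filter-++ (regular? t) xss yss) ⟩
    sum (map φ (xs ++ ys))                          ≡⟨ cong sum (map-++ φ xs ys) ⟩
    sum (map φ xs ++ map φ ys)                      ≡⟨ sum-++ (map φ xs) (map φ ys) ⟩
    sum (map φ xs) + sum (map φ ys)                 ∎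
    where
    open ≡-Reasoning
    xs = filter (regular? t) xss
    ys = filter (regular? t) yss

  total-small : ∀ φ {m n} → n < suc m → total t φ (suc m) n ≡ total t φ m n
  total-small φ {m} {n} lt = cong (sum ∘ map φ ∘ filter (regular? t)) (parts-small m n lt)

  -- The recurrence on the largest part allowed; all later identities for sums
  -- over regular partitions come from it and total-∣.
  total-∤ : ∀ φ m → ¬ t ∣ suc m →
        total t φ (suc m) ≗ total t φ m ⊕ S (suc m) (total t (φ ∘ (suc m ∷_)) (suc m))
  total-∤ φ m t∤ n with suc m ≤? n
  ... | no  m≮n = trans (total-small φ (≰⇒> m≮n))
        (sym (trans (cong (total t φ m n +_) (S-< _ (≰⇒> m≮n))) (+-identityʳ _)))
  ... | yes m<n = begin
    total t φ (suc m) n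
      ≡⟨ cong (sum ∘ map φ ∘ filter (regular? t)) (parts-large m n m<n) ⟩
    sum (map φ (filter (regular? t) (parts m n ++ map (suc m ∷_) ps)))
      ≡⟨ total-++ φ (parts m n) _ ⟩
    total t φ m n + sum (map φ (filter (regular? t) (map (suc m ∷_) ps)))
      ≡⟨ cong (λ l → total t φ m n + sum (map φ l)) (filter-∤ t∤ ps) ⟩
    total t φ m n + sum (map φ (map (suc m ∷_) (filter (regular? t) ps)))
      ≡⟨ cong (λ l → total t φ m n + sum l)
          (map-∘ {g = φ} {f = suc m ∷_} (filter (regular? t) ps)) ⟨
    total t φ m n + total t (φ ∘ (suc m ∷_)) (suc m) (n ∸ suc m)
      ≡⟨ cong (total t φ m n +_) (S-≤ _ m<n) ⟨
    total t φ m n + S (suc m) (total t (φ ∘ (suc m ∷_)) (suc m)) n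
      ∎
    where
    open ≡-Reasoning
    ps = parts (suc m) (n ∸ suc m)

  total-∣ : ∀ φ m → t ∣ suc m → total t φ (suc m) ≗ total t φ m
  total-∣ φ m t∣ n with suc m ≤? n
  ... | no  m≮n = total-small φ (≰⇒> m≮n)
  ... | yes m<n = begin
    total t φ (suc m) n
      ≡⟨ cong (sum ∘ map φ ∘ filter (regular? t)) (parts-large m n m<n) ⟩
    sum (map φ (filter (regular? t) (parts m n ++ map (suc m ∷_) ps)))
      ≡⟨ total-++ φ (parts m n) _ ⟩
    total t φ m n + sum (map φ (filter (regular? t) (map (suc m ∷_) ps)))
      ≡⟨ cong (λ l → total t φ m n + sum (map φ l)) (filter-∣ t∣ ps) ⟩
    total t φ m n + 0
      ≡⟨ +-identityʳ _ ⟩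
    total t φ m n
      ∎
    where
    open ≡-Reasoning
    ps = parts (suc m) (n ∸ suc m)

  -- Parts larger than n do not matter for the coefficient at n.
  total-stable : ∀ φ {m n} → n ≤ m → total t φ m n ≡ total t φ n n
  total-stable φ {m} {n} n≤m = trans (cong (λ k → total t φ k n) (sym (m∸n+n≡m n≤m))) (go (m ∸ n))
    where
    go : ∀ d → total t φ (d + n) n ≡ total t φ n n
    go zero    = refl
    go (suc d) = trans (total-small φ (s≤s (m≤n+m n d))) (go d)

-- Hooks of length 2 in the first row

-- The indicators of 0 and 1.
is0 : ℕ → ℕ
is0 zero    = 1
is0 (suc _) = 0

is1 : ℕ → ℕ
is1 zero    = 0
is1 (suc n) = is0 n

-- The number of parts greater than j: the leg of a box in column j (counted from
-- 0) of a row placed above xs.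
above : ℕ → List ℕ → ℕ
above j xs = length (filter (j <?_) xs)

above-none : ∀ {m xs} → All (_≤ m) xs → above m xs ≡ 0
above-none {m} le = cong length (filter-none (m <?_) (All.map ≤⇒≯ le))

above-∷ : ∀ {j x} xs → j < x → above j (x ∷ xs) ≡ suc (above j xs)
above-∷ {j} xs j<x = cong length (filter-accept (j <?_) j<x)

-- The indicator of having no part of size at least m.  For m = 0 it is 0, since a
-- row of length suc m = 1 has no box with exactly one box to its right.
noneFrom : ℕ → Weight
noneFrom zero    xs = 0
noneFrom (suc k) xs = is0 (above k xs)

-- A box at least two places from the end of its row has an arm of at least
-- two boxes.
hookLength-left : ∀ k xs {j} → j < k → hookLength (suc (suc k)) xs j ≢ 2
hookLength-left k xs {j} j<k eq = <⇒≱ (m<n⇒0<n∸m j<k) (s≤s⁻¹ (begin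
  suc (k ∸ j)                ≡⟨ +-∸-assoc 1 (<⇒≤ j<k) ⟨
  suc k ∸ j                  ≤⟨ m≤m+n _ (above j xs) ⟩
  (suc k ∸ j) + above j xs   ≡⟨ +-cancelʳ-≡ 1 _ 1 eq ⟩
  1                          ∎))
  where open ≤-Reasoning

-- The number of entries equal to 2.
twos : List ℕ → ℕ
twos = length ∘ filter (_≟ 2)

twos-++ : ∀ xs ys → twos (xs ++ ys) ≡ twos xs + twos ys
twos-++ xs ys = trans (cong length (filter-++ (_≟ 2) xs ys)) (length-++ (filter (_≟ 2) xs))

twos-upTo : ∀ h j → twos (map h (upTo (suc j))) ≡ twos (map h (upTo j)) + twos (h j ∷ [])
twos-upTo h j = begin
  twos (map h (upTo (suc j)))              ≡⟨ cong (twos ∘ map h) (upTo-∷ʳ j) ⟨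
  twos (map h (upTo j ∷ʳ j))               ≡⟨ cong twos (map-++ h (upTo j) (j ∷ [])) ⟩
  twos (map h (upTo j) ++ h j ∷ [])        ≡⟨ twos-++ (map h (upTo j)) _ ⟩
  twos (map h (upTo j)) + twos (h j ∷ [])  ∎
  where open ≡-Reasoning

-- The last box of a row has hook length 2 when its leg is 1, and the box before
-- it when its leg is 0.
twos-arm0 : ∀ c → twos (0 + c + 1 ∷ []) ≡ is1 c
twos-arm0 0             = refl
twos-arm0 1             = refl
twos-arm0 (suc (suc c)) rewrite +-comm c 1 = refl

twos-arm1 : ∀ c → twos (1 + c + 1 ∷ []) ≡ is0 c
twos-arm1 0       = refl
twos-arm1 (suc c) rewrite +-comm c 1 = refl

-- Only the last two boxes of a row can have hook length 2.
twos-row : ∀ m xs → twos (map (hookLength (suc m) xs) (upTo (suc m))) ≡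
           is1 (above m xs) + noneFrom m xs
twos-row m xs = trans (twos-upTo (hookLength (suc m) xs) m)
  (trans (+-comm (twos (map (hookLength (suc m) xs) (upTo m))) _) (cong₂ _+_ last (init m)))
  where
  last : twos (hookLength (suc m) xs m ∷ []) ≡ is1 (above m xs)
  last = trans (cong (λ d → twos (d + above m xs + 1 ∷ [])) (n∸n≡0 m)) (twos-arm0 (above m xs))

  init : ∀ m → twos (map (hookLength (suc m) xs) (upTo m)) ≡ noneFrom m xs
  init zero    = refl
  init (suc k) = begin
    twos (map r (upTo (suc k)))                ≡⟨ twos-upTo r k ⟩
    twos (map r (upTo k)) + twos (r k ∷ [])    ≡⟨ cong (_+ twos (r k ∷ [])) none ⟩
    twos (r k ∷ [])
        ≡⟨ cong (λ d → twos (d + above k xs + 1 ∷ [])) (m+n∸n≡m 1 k) ⟩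
    twos (1 + above k xs + 1 ∷ [])             ≡⟨ twos-arm1 (above k xs) ⟩
    is0 (above k xs)                           ∎
    where
    open ≡-Reasoning
    r = hookLength (suc (suc k)) xs
    none : twos (map r (upTo k)) ≡ 0
    none = cong length (filter-none (_≟ 2)
      (All.map⁺ (All.map (hookLength-left k xs) (All.all-upTo k))))

hookCount-∷ : ∀ m xs → hookCount 2 (suc m ∷ xs) ≡
              is1 (above m xs) + noneFrom m xs + hookCount 2 xs
hookCount-∷ m xs = trans (twos-++ (map (hookLength (suc m) xs) (upTo (suc m))) (hookLengths xs))
  (cong (_+ hookCount 2 xs) (twos-row m xs))

-- Recurrences for regular partitions and their hooks

module _ (t : ℕ) where

  -- The number of t-regular partitions into parts at most m.
  regulars : ℕ → Seq
  regulars = total t (const 1)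

  -- The number of hooks of length 2 in these partitions.
  hooks : ℕ → Seq
  hooks = total t (hookCount 2)

  regulars-∤ : ∀ m → ¬ t ∣ suc m → regulars (suc m) ≗ regulars m ⊕ S (suc m) (regulars (suc m))
  regulars-∤ = total-∤ t (const 1)

  -- Partitions without a part above k are those into parts at most k.
  total-none : ∀ k → total t (λ xs → is0 (above k xs)) k ≗ regulars k
  total-none k = total-cong t k (λ le → cong is0 (above-none le))

  total-none-suc : ∀ k {m} → k ≤ m → total t (λ xs → is0 (above k xs)) (suc m) ≗
                   total t (λ xs → is0 (above k xs)) m
  total-none-suc k {m} k≤m n with t ∣? suc m
  ... | yes t∣ = total-∣ t _ m t∣ n
  ... | no t∤ = begin
    total t φ (suc m) n                                         ≡⟨ total-∤ t φ m t∤ n ⟩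
    total t φ m n + S (suc m) (total t (φ ∘ (suc m ∷_)) (suc m)) n
        ≡⟨ cong (total t φ m n +_) (S-cong (suc m) zeros n) ⟩
    total t φ m n + S (suc m) 𝟘 n
        ≡⟨ cong (total t φ m n +_) (S-𝟘 (suc m) n) ⟩
    total t φ m n + 0                                           ≡⟨ +-identityʳ _ ⟩
    total t φ m n                                               ∎
    where
    open ≡-Reasoning
    φ : Weight
    φ xs = is0 (above k xs)
    zeros : total t (φ ∘ (suc m ∷_)) (suc m) ≗ 𝟘
    zeros n = trans (total-cong t (suc m) (λ {xs} _ → cong is0 (above-∷ xs (s≤s k≤m))) n)
        (total-𝟘 t (suc m) n)

  -- The partitions in which suc m is the largest part and occurs exactly once
  -- are obtained by adding suc m to the partitions into parts at most m.
  total-one : ∀ m → ¬ t ∣ suc m → total t (λ xs → is1 (above m xs)) (suc m) ≗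
              S (suc m) (regulars m)
  total-one m t∤ n = begin
    total t φ (suc m) n                                         ≡⟨ total-∤ t φ m t∤ n ⟩
    total t φ m n + S (suc m) (total t (φ ∘ (suc m ∷_)) (suc m)) n
        ≡⟨ cong₂ _+_ (trans (total-cong t m (λ le → cong is1 (above-none le)) n) (total-𝟘 t m n))
            (S-cong (suc m) tail n) ⟩
    S (suc m) (regulars m) n                                       ∎
    where
    open ≡-Reasoning
    φ : Weight
    φ xs = is1 (above m xs)
    tail : total t (φ ∘ (suc m ∷_)) (suc m) ≗ regulars m
    tail n = trans (total-cong t (suc m) (λ {xs} _ → cong is1 (above-∷ xs ≤-refl)) n)
      (trans (total-none-suc m ≤-refl n) (total-none m n))

  -- The number of t-regular partitions into parts smaller than m; the value 0 at
  -- m = 0 agrees with that of noneFrom.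
  regularsBelow : ℕ → Seq
  regularsBelow zero    = 𝟘
  regularsBelow (suc k) = regulars k

  total-noneFrom : ∀ m → total t (noneFrom m) (suc m) ≗ regularsBelow m
  total-noneFrom zero    n = total-𝟘 t 1 n
  total-noneFrom (suc k) n = trans (total-none-suc k (n≤1+n k) n)
    (trans (total-none-suc k ≤-refl n) (total-none k n))

  -- Removing a first part suc m removes one hook of length 2 when suc m occurs
  -- exactly once in the rest, and one when m is positive and no part of the rest
  -- is at least m.
  hooks-∤ : ∀ m → ¬ t ∣ suc m →
            hooks (suc m) ≗
            hooks m ⊕ S (suc m) (S (suc m) (regulars m) ⊕ regularsBelow m ⊕ hooks (suc m))
  hooks-∤ m t∤ n = trans (total-∤ t (hookCount 2) m t∤ n)
    (cong (hooks m n +_) (S-cong (suc m) eq n))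
    where
    eq : total t (hookCount 2 ∘ (suc m ∷_)) (suc m) ≗
         S (suc m) (regulars m) ⊕ regularsBelow m ⊕ hooks (suc m)
    eq n = begin
      total t (hookCount 2 ∘ (suc m ∷_)) (suc m) n
        ≡⟨ total-cong t (suc m) (λ {xs} _ → hookCount-∷ m xs) n ⟩
      total t (λ xs → is1 (above m xs) + noneFrom m xs + hookCount 2 xs) (suc m) n
        ≡⟨ total-⊕ t (suc m) (λ xs → is1 (above m xs) + noneFrom m xs) _ n ⟩
      total t (λ xs → is1 (above m xs) + noneFrom m xs) (suc m) n + hooks (suc m) n
        ≡⟨ cong (_+ hooks (suc m) n) (total-⊕ t (suc m) (λ xs → is1 (above m xs)) (noneFrom m) n) ⟩
      total t (λ xs → is1 (above m xs)) (suc m) n + total t (noneFrom m) (suc m) n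
        + hooks (suc m) n
        ≡⟨ cong (_+ hooks (suc m) n) (cong₂ _+_ (total-one m t∤ n) (total-noneFrom m n)) ⟩
      S (suc m) (regulars m) n + regularsBelow m n + hooks (suc m) n ∎
      where open ≡-Reasoning

-- Glaisher's comparison

∣-block : ∀ t k → t ∣ k * t
∣-block t k = n∣m*n k

∤-block : ∀ {t} a .{{_ : NonZero a}} k → a < t → ¬ t ∣ a + k * t
∤-block {t} a k a<t t∣ = >⇒∤ a<t (∣m+n∣m⇒∣n (subst (t ∣_) (+-comm a (k * t)) t∣) (n∣m*n k))

regulars-P : ∀ t m → ¬ t ∣ suc m → regulars t (suc m) ≗ P (suc m) (regulars t m)
regulars-P t m t∤ = P-unique (suc m) (regulars-∤ t m t∤)

-- The power series 1.
δ : Seq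
δ zero    = 1
δ (suc _) = 0

regulars-zero : ∀ t → regulars t 0 ≗ δ
regulars-zero t zero    = refl
regulars-zero t (suc n) = refl

-- The generating function of all partitions into parts at most m.
unrestricted : ℕ → Seq
unrestricted zero    = δ
unrestricted (suc m) = P (suc m) (unrestricted m)

unrestricted-stable : ∀ d {m n} → n ≤ m → unrestricted (d + m) n ≡ unrestricted m n
unrestricted-stable zero    n≤m = refl
unrestricted-stable (suc d) {m} {n} n≤m = begin
  P (suc (d + m)) (unrestricted (d + m)) n
      ≡⟨ P-fix (suc (d + m)) (unrestricted (d + m)) n ⟩
  unrestricted (d + m) n + S (suc (d + m)) (P (suc (d + m)) (unrestricted (d + m))) n
      ≡⟨ cong (unrestricted (d + m) n +_) (S-< _ (s≤s (≤-trans n≤m (m≤n+m m d)))) ⟩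
  unrestricted (d + m) n + 0
      ≡⟨ +-identityʳ _ ⟩
  unrestricted (d + m) n
      ≡⟨ unrestricted-stable d n≤m ⟩
  unrestricted m n                                                               ∎
  where open ≡-Reasoning

module _ (t : ℕ) where

  -- The product of f and 1 / (1 - q^x) over the multiples x of t that are at most
  -- m.
  multiplesSeries : ℕ → Seq → Seq
  multiplesSeries zero    f = f
  multiplesSeries (suc m) f with t ∣? suc m
  ... | yes _ = P (suc m) (multiplesSeries m f)
  ... | no  _ = multiplesSeries m f

  multiplesSeries-∣ : ∀ {m} f → t ∣ suc m →
                      multiplesSeries (suc m) f ≗ P (suc m) (multiplesSeries m f)
  multiplesSeries-∣ {m} f t∣ n with t ∣? suc m
  ... | yes _ = refl
  ... | no t∤ = ⊥-elim (t∤ t∣)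

  multiplesSeries-∤ : ∀ {m} f → ¬ t ∣ suc m → multiplesSeries (suc m) f ≗ multiplesSeries m f
  multiplesSeries-∤ {m} f t∤ n with t ∣? suc m
  ... | yes t∣ = ⊥-elim (t∤ t∣)
  ... | no _   = refl

  multiplesSeries-cong : ∀ m {f g} → f ≗ g → multiplesSeries m f ≗ multiplesSeries m g
  multiplesSeries-cong zero    eq n = eq n
  multiplesSeries-cong (suc m) eq n with t ∣? suc m
  ... | yes _ = P-cong (suc m) (multiplesSeries-cong m eq) n
  ... | no  _ = multiplesSeries-cong m eq n

  multiplesSeries-injective≤ : ∀ m {f g} N →
      (∀ {k} → k ≤ N → multiplesSeries m f k ≡ multiplesSeries m g k) → ∀ {n} → n ≤ N → f n ≡ g n
  multiplesSeries-injective≤ zero    N eq = eq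
  multiplesSeries-injective≤ (suc m) N eq with t ∣? suc m
  ... | yes _ = multiplesSeries-injective≤ m N (P-injective≤ (suc m) N eq)
  ... | no  _ = multiplesSeries-injective≤ m N eq

  multiplesSeries-P : ∀ m x .{{_ : NonZero x}} f →
                      multiplesSeries m (P x f) ≗ P x (multiplesSeries m f)
  multiplesSeries-P zero    x f n = refl
  multiplesSeries-P (suc m) x f n with t ∣? suc m
  ... | yes _ = trans (P-cong (suc m) (multiplesSeries-P m x f) n)
      (P-P (suc m) x (multiplesSeries m f) n)
  ... | no  _ = multiplesSeries-P m x f n

  multiplesSeries-M : ∀ m x .{{_ : NonZero x}} f →
                      multiplesSeries m (M t x f) ≗ M t x (multiplesSeries m f)
  multiplesSeries-M zero    x f n = refl
  multiplesSeries-M (suc m) x f n with t ∣? suc m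
  ... | yes _ = trans (P-cong (suc m) (multiplesSeries-M m x f) n)
      (P-M (suc m) t x (multiplesSeries m f) n)
  ... | no  _ = multiplesSeries-M m x f n

  -- Parts not divisible by t together with parts divisible by t are all parts.
  multiplesSeries-regulars : ∀ m → multiplesSeries m (regulars t m) ≗ unrestricted m
  multiplesSeries-regulars zero    = regulars-zero t
  multiplesSeries-regulars (suc m) n with t ∣? suc m
  ... | yes t∣ = P-cong (suc m)
        (λ k → trans (multiplesSeries-cong m (total-∣ t (const 1) m t∣) k)
            (multiplesSeries-regulars m k)) n
  ... | no  t∤ = trans (multiplesSeries-cong m (regulars-P t m t∤) n)
        (trans (multiplesSeries-P m (suc m) (regulars t m) n)
            (P-cong (suc m) (multiplesSeries-regulars m) n))

  -- The generating function of the partitions into parts at most m with each part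
  -- repeated less than t times.
  bounded : ℕ → Seq
  bounded zero    = δ
  bounded (suc m) = M t (suc m) (bounded m)

-- There is no multiple of t strictly between m * t and suc m * t.
multiplesSeries-block : ∀ s m f d → d ≤ s →
  multiplesSeries (suc s) (d + m * suc s) f ≗ multiplesSeries (suc s) (m * suc s) f
multiplesSeries-block s m f zero    d≤s n = refl
multiplesSeries-block s m f (suc d) d<s n = trans
  (multiplesSeries-∤ (suc s) f (∤-block (suc d) m (s≤s d<s)) n)
  (multiplesSeries-block s m f d (<⇒≤ d<s) n)

-- The factor 1 / (1 - q^(tx)) turns a part x repeated less than t times into a
-- part x repeated arbitrarily often.
multiplesSeries-bounded : ∀ s m →
  multiplesSeries (suc s) (m * suc s) (bounded (suc s) m) ≗ unrestricted m
multiplesSeries-bounded s zero    n = refl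
multiplesSeries-bounded s (suc m) n = begin
  multiplesSeries t (suc (s + m * t)) (M t (suc m) d) n
      ≡⟨ multiplesSeries-∣ t _ (n∣m*n (suc m)) n ⟩
  P (suc m * t) (multiplesSeries t (s + m * t) (M t (suc m) d)) n
      ≡⟨ P-cong (suc m * t) (multiplesSeries-block s m _ s ≤-refl) n ⟩
  P (suc m * t) (multiplesSeries t (m * t) (M t (suc m) d)) n
      ≡⟨ P-cong (suc m * t) (multiplesSeries-M t (m * t) (suc m) d) n ⟩
  P (suc m * t) (M t (suc m) (multiplesSeries t (m * t) d)) n
      ≡⟨ cong (λ x → P x (M t (suc m) (multiplesSeries t (m * t) d)) n) (*-comm (suc m) t) ⟩
  P (t * suc m) (M t (suc m) (multiplesSeries t (m * t) d)) n ≡⟨ P-of-M t (suc m) _ n ⟩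
  P (suc m) (multiplesSeries t (m * t) d) n
      ≡⟨ P-cong (suc m) (multiplesSeries-bounded s m) n ⟩
  unrestricted (suc m) n                                   ∎
  where
  open ≡-Reasoning
  t = suc s
  d = bounded t m

-- Glaisher's theorem.  Both series become the series of all partitions, up to
-- degree m, after multiplication by multiplesSeries t (m * t), and this can be
-- cancelled.
bounded≡regulars : ∀ t .{{_ : NonZero t}} m {n} → n ≤ m → bounded t m n ≡ regulars t n n
bounded≡regulars t@(suc s) m {n} n≤m = trans (multiplesSeries-injective≤ t (m * t) m eq n≤m)
  (total-stable t (const 1) (≤-trans n≤m (m≤m*n m t)))
  where
  eq : ∀ {k} → k ≤ m → multiplesSeries t (m * t) (bounded t m) k ≡
                       multiplesSeries t (m * t) (regulars t (m * t)) k
  eq {k} k≤m = begin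
    multiplesSeries t (m * t) (bounded t m) k           ≡⟨ multiplesSeries-bounded s m k ⟩
    unrestricted m k                           ≡⟨ unrestricted-stable (m * t ∸ m) k≤m ⟨
    unrestricted (m * t ∸ m + m) k
        ≡⟨ cong (λ x → unrestricted x k) (m∸n+n≡m (m≤m*n m t)) ⟩
    unrestricted (m * t) k                     ≡⟨ multiplesSeries-regulars t (m * t) k ⟨
    multiplesSeries t (m * t) (regulars t (m * t)) k     ∎
    where open ≡-Reasoning

bounded-mono : ∀ t m → bounded t m ≼ bounded (suc t) m
bounded-mono t zero    n = ≤-refl
bounded-mono t (suc m) n = ≤-trans
  (M-mono≤ t (suc m) n (λ {k} _ → bounded-mono t m k) ≤-refl)
  (M-suc-≼ t (suc m) _ n)

regulars-mono : ∀ t .{{_ : NonZero t}} m m′ {n} → n ≤ m → n ≤ m′ →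
                regulars t m n ≤ regulars (suc t) m′ n
regulars-mono t m m′ {n} n≤m n≤m′ = begin
  regulars t m n         ≡⟨ total-stable t (const 1) n≤m ⟩
  regulars t n n         ≡⟨ bounded≡regulars t n ≤-refl ⟨
  bounded t n n          ≤⟨ bounded-mono t n n ⟩
  bounded (suc t) n n    ≡⟨ bounded≡regulars (suc t) n ≤-refl ⟩
  regulars (suc t) n n   ≡⟨ total-stable (suc t) (const 1) n≤m′ ⟨
  regulars (suc t) m′ n  ∎
  where open ≤-Reasoning

-- Polynomial multiples

-- The product of f and the polynomial that has one term q^e for each entry e of
-- the list.
poly : List ℕ → Seq → Seq
poly []       f = 𝟘
poly (e ∷ es) f = S e f ⊕ poly es f

poly-++ : ∀ xs ys f → poly (xs ++ ys) f ≗ poly xs f ⊕ poly ys f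
poly-++ []       ys f n = refl
poly-++ (x ∷ xs) ys f n = trans (cong (S x f n +_) (poly-++ xs ys f n))
    (sym (+-assoc (S x f n) _ _))

poly-cong : ∀ xs {f g} → f ≗ g → poly xs f ≗ poly xs g
poly-cong []       eq n = refl
poly-cong (x ∷ xs) eq n = cong₂ _+_ (S-cong x eq n) (poly-cong xs eq n)

poly-mono≤ : ∀ xs {f g} N → (∀ {k} → k ≤ N → f k ≤ g k) →
             ∀ {n} → n ≤ N → poly xs f n ≤ poly xs g n
poly-mono≤ []       N le n≤N = z≤n
poly-mono≤ (x ∷ xs) N le n≤N = +-mono-≤ (S-mono≤ x N le n≤N) (poly-mono≤ xs N le n≤N)

poly-shift : ∀ x xs f → poly (map (x +_) xs) f ≗ S x (poly xs f)
poly-shift x []       f n = sym (S-𝟘 x n)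
poly-shift x (y ∷ xs) f n = trans (cong₂ _+_ (sym (S-S x y f n)) (poly-shift x xs f n))
  (sym (S-⊕ x (S y f) (poly xs f) n))

poly-↭ : ∀ {xs ys} f → xs ↭ ys → poly xs f ≗ poly ys f
poly-↭ f Perm.refl        n = refl
poly-↭ f (prep x p)       n = cong (S x f n +_) (poly-↭ f p n)
poly-↭ f (swap x y p)     n = trans (cong (λ z → S x f n + (S y f n + z)) (poly-↭ f p n))
    (rot (S x f n) (S y f n) _)
  where
  rot : ∀ a b c → a + (b + c) ≡ b + (a + c)
  rot = solve-∀
poly-↭ f (Perm.trans p q) n = trans (poly-↭ f p n) (poly-↭ f q n)

-- Polynomials are compared by computing the sorted lists of their exponents.
poly-sort : ∀ xs ys f → sort xs ≡ sort ys → poly xs f ≗ poly ys f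
poly-sort xs ys f eq = poly-↭ f
    (↭-trans (↭-sym (sort-↭ xs)) (↭-trans (↭-reflexive eq) (sort-↭ ys)))

poly-fix : ∀ x {f g} xs → g ≗ f ⊕ S x g → poly xs g ≗ poly xs f ⊕ S x (poly xs g)
poly-fix x         []       eq n = sym (S-𝟘 x n)
poly-fix x {f} {g} (y ∷ xs) eq n = begin
  S y g n + poly xs g n
    ≡⟨ cong₂ _+_ (S-cong y eq n) (poly-fix x xs eq n) ⟩
  S y (f ⊕ S x g) n + (poly xs f n + S x (poly xs g) n)
    ≡⟨ cong (_+ (poly xs f n + S x (poly xs g) n))
        (trans (S-⊕ y f (S x g) n) (cong (S y f n +_) (S-swap y x g n))) ⟩
  (S y f n + S x (S y g) n) + (poly xs f n + S x (poly xs g) n)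
    ≡⟨ interchange (S y f n) _ _ _ ⟩
  (S y f n + poly xs f n) + (S x (S y g) n + S x (poly xs g) n)
    ≡⟨ cong (S y f n + poly xs f n +_) (S-⊕ x (S y g) (poly xs g) n) ⟨
  (S y f n + poly xs f n) + S x (S y g ⊕ poly xs g) n ∎
  where open ≡-Reasoning

-- The generating function of the hooks of length 2

-- The generating function of the hooks of length 2 in t-regular partitions into
-- parts at most m is that of these partitions times the polynomial pos - neg,
-- given by two lists of exponents.
record Closed (t m : ℕ) (pos neg : List ℕ) : Set where
  constructor closed
  field
    identity : hooks t m ⊕ poly neg (regulars t m) ≗ poly pos (regulars t m)

closed-zero : ∀ t → Closed t 0 [] []
closed-zero t = closed λ where
  zero    → refl
  (suc n) → refl

closed-∣ : ∀ t m {pos neg} → t ∣ suc m → Closed t m pos neg → Closed t (suc m) pos neg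
closed-∣ t m {pos} {neg} t∣ (closed c) = closed λ n → begin
  hooks t (suc m) n + poly neg (regulars t (suc m)) n
      ≡⟨ cong₂ _+_ (total-∣ t _ m t∣ n) (poly-cong neg (total-∣ t _ m t∣) n) ⟩
  hooks t m n + poly neg (regulars t m) n             ≡⟨ c n ⟩
  poly pos (regulars t m) n                       ≡⟨ poly-cong pos (total-∣ t _ m t∣) n ⟨
  poly pos (regulars t (suc m)) n                 ∎
  where open ≡-Reasoning

-- A new part size x = suc m contributes q^x + q^(2x) - q^x ν, where ν is 0 or a
-- single power of q.  The hypothesis says that ν times regulars t m counts the
-- partitions into parts at most m that contain m or, for m = 0, all of them.
-- Both sides of the new identity satisfy an equation f = a + q^x f with the
-- same a.
closed-∤ : ∀ t m {pos neg} ν → ¬ t ∣ suc m →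
  regularsBelow t m ⊕ poly ν (regulars t m) ≗ regulars t m →
  Closed t m pos neg →
  Closed t (suc m) (suc m ∷ suc m + suc m ∷ pos) (map (suc m +_) ν ++ neg)
closed-∤ t m {pos} {neg} ν t∤ cν (closed c) =
  closed (fix-unique x eq (poly-fix x pos′ (regulars-∤ t m t∤)))
  where
  open ≡-Reasoning
  x = suc m
  pos′ neg′ : List ℕ
  pos′ = x ∷ x + x ∷ pos
  neg′ = map (x +_) ν ++ neg
  r = regulars t m
  rx = regulars t x
  hx = hooks t x
  shuffle₁ : ∀ h s c hx ν n k → (h + (s + c + hx)) + ((ν + n) + k) ≡
             (h + n) + (s + (c + ν)) + (hx + k)
  shuffle₁ = solve-∀
  shuffle₂ : ∀ p s r k → p + (s + r) + k ≡ (r + (s + p)) + k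
  shuffle₂ = solve-∀
  eq : hx ⊕ poly neg′ rx ≗ poly pos′ r ⊕ S x (hx ⊕ poly neg′ rx)
  eq n = begin
    hx n + poly neg′ rx n
      ≡⟨ cong₂ _+_ (hooks-∤ t m t∤ n) (poly-fix x neg′ (regulars-∤ t m t∤) n) ⟩
    (hooks t m n + S x (S x r ⊕ regularsBelow t m ⊕ hx) n) +
        (poly neg′ r n + S x (poly neg′ rx) n)
      ≡⟨ cong₂ (λ a b → (hooks t m n + a) + (b + S x (poly neg′ rx) n))
           (trans (S-⊕ x (S x r ⊕ regularsBelow t m) hx n)
               (cong (_+ S x hx n) (S-⊕ x (S x r) (regularsBelow t m) n)))
           (trans (poly-++ (map (x +_) ν) neg r n) (cong (_+ poly neg r n) (poly-shift x ν r n))) ⟩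
    (hooks t m n + (S x (S x r) n + S x (regularsBelow t m) n + S x hx n)) +
        ((S x (poly ν r) n + poly neg r n) + S x (poly neg′ rx) n)
      ≡⟨ shuffle₁ (hooks t m n) (S x (S x r) n) _ _ _ _ _ ⟩
    (hooks t m n + poly neg r n) +
        (S x (S x r) n + (S x (regularsBelow t m) n + S x (poly ν r) n)) +
            (S x hx n + S x (poly neg′ rx) n)
      ≡⟨ cong₂ _+_ (cong₂ _+_ (c n) (cong₂ _+_ (S-S x x r n)
            (trans (sym (S-⊕ x (regularsBelow t m) (poly ν r) n)) (S-cong x cν n))))
                (sym (S-⊕ x hx (poly neg′ rx) n)) ⟩
    poly pos r n + (S (x + x) r n + S x r n) + S x (hx ⊕ poly neg′ rx) n
      ≡⟨ shuffle₂ (poly pos r n) (S (x + x) r n) (S x r n) _ ⟩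
    poly pos′ r n + S x (hx ⊕ poly neg′ rx) n ∎

-- The three cases for ν: at m = 0, regularsBelow is 0 and ν = 1 makes up for
-- it; for m not divisible by t, ν = q^m; for a positive m divisible by t, m is
-- never a part and ν = 0.
regularsBelow-0 : ∀ t → regularsBelow t 0 ⊕ poly (0 ∷ []) (regulars t 0) ≗ regulars t 0
regularsBelow-0 t n = +-identityʳ _

regularsBelow-∤ : ∀ t m → ¬ t ∣ suc m →
  regularsBelow t (suc m) ⊕ poly (suc m ∷ []) (regulars t (suc m)) ≗ regulars t (suc m)
regularsBelow-∤ t m t∤ n = trans (cong (regulars t m n +_) (+-identityʳ _))
    (sym (regulars-∤ t m t∤ n))

regularsBelow-∣ : ∀ t m → t ∣ suc m →
  regularsBelow t (suc m) ⊕ poly [] (regulars t (suc m)) ≗ regulars t (suc m)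
regularsBelow-∣ t m t∣ n = trans (+-identityʳ _) (sym (total-∣ t _ m t∣ n))

-- Periodic exponents

-- The exponents start, start + step, start + 2 step, ...
infix 6 _mod_
record Progression : Set where
  constructor _mod_
  field
    start step        : ℕ
    .{{step-nonZero}} : NonZero step
open Progression

-- The k-th terms of the progressions, counted from 0.
terms : List Progression → ℕ → List ℕ
terms ps k = map (λ p → start p + k * step p) ps

-- All terms with index smaller than k, together with the exponents in base.
termsBelow : List ℕ → List Progression → ℕ → List ℕ
termsBelow base ps zero    = base
termsBelow base ps (suc k) = terms ps k ++ termsBelow base ps k

-- The product of f and all terms with index at least k, in the closed form
-- q^(start + k step) f / (1 - q^step).
tails : List Progression → ℕ → Seq → Seq
tails []       k f = 𝟘
tails (p ∷ ps) k f = S (start p + k * step p) (P (step p) f) ⊕ tails ps k f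

tails-suc : ∀ ps k f → tails ps k f ≗ poly (terms ps k) f ⊕ tails ps (suc k) f
tails-suc []       k f n = refl
tails-suc (p ∷ ps) k f n = begin
  S a (P d f) n + tails ps k f n
    ≡⟨ cong₂ _+_ (trans (S-cong a (P-fix d f) n) (S-⊕ a f (S d (P d f)) n)) (tails-suc ps k f n) ⟩
  (S a f n + S a (S d (P d f)) n) + (poly (terms ps k) f n + tails ps (suc k) f n)
    ≡⟨ interchange (S a f n) _ _ _ ⟩
  (S a f n + poly (terms ps k) f n) + (S a (S d (P d f)) n + tails ps (suc k) f n)
    ≡⟨ cong (λ z → (S a f n + poly (terms ps k) f n) + (z + tails ps (suc k) f n))
         (trans (S-S a d (P d f) n) (cong (λ e → S e (P d f) n) (assoc (start p) (k * d) d))) ⟩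
  (S a f n + poly (terms ps k) f n) + (S (start p + suc k * d) (P d f) n + tails ps (suc k) f n) ∎
  where
  open ≡-Reasoning
  a = start p + k * step p
  d = step p
  assoc : ∀ a b c → a + b + c ≡ a + (c + b)
  assoc = solve-∀

tails-vanish : ∀ ps {k n} f → n < k → tails ps k f n ≡ 0
tails-vanish []       f n<k = refl
tails-vanish (p ∷ ps) {k} {n} f n<k = cong₂ _+_
  (S-< _ (≤-trans n<k (≤-trans (m≤m*n k (step p)) (m≤n+m _ (start p)))))
  (tails-vanish ps f n<k)

poly-termsBelow-tails : ∀ base ps k f →
  poly (termsBelow base ps k) f ⊕ tails ps k f ≗ tails ps 0 f ⊕ poly base f
poly-termsBelow-tails base ps zero    f n = +-comm (poly base f n) _
poly-termsBelow-tails base ps (suc k) f n = begin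
  poly (terms ps k ++ termsBelow base ps k) f n + tails ps (suc k) f n
    ≡⟨ cong (_+ tails ps (suc k) f n) (poly-++ (terms ps k) _ f n) ⟩
  poly (terms ps k) f n + poly (termsBelow base ps k) f n + tails ps (suc k) f n
    ≡⟨ shuffle (poly (terms ps k) f n) _ _ ⟩
  poly (termsBelow base ps k) f n + (poly (terms ps k) f n + tails ps (suc k) f n)
    ≡⟨ cong (poly (termsBelow base ps k) f n +_) (tails-suc ps k f n) ⟨
  poly (termsBelow base ps k) f n + tails ps k f n
    ≡⟨ poly-termsBelow-tails base ps k f n ⟩
  tails ps 0 f n + poly base f n ∎
  where
  open ≡-Reasoning
  shuffle : ∀ a b c → a + b + c ≡ b + (a + c)
  shuffle = solve-∀

-- The first t multiples of d, starting with 0.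
multiples : ℕ → ℕ → List ℕ
multiples zero    d = []
multiples (suc t) d = 0 ∷ map (d +_) (multiples t d)

M-multiples : ∀ t d f → M t d f ≗ poly (multiples t d) f
M-multiples zero    d f n = refl
M-multiples (suc t) d f n = cong (f n +_)
  (trans (S-cong d (M-multiples t d f) n) (sym (poly-shift d (multiples t d) f n)))

P-multiples : ∀ q d {N} .{{_ : NonZero d}} .{{_ : NonZero N}} f → q * d ≡ N →
              P d f ≗ poly (multiples q d) (P N f)
P-multiples q d f refl n = begin
  P d f n                            ≡⟨ P-of-M q d f n ⟨
  P (q * d) (M q d f) n              ≡⟨ P-M (q * d) q d f n ⟩
  M q d (P (q * d) f) n              ≡⟨ M-multiples q d (P (q * d) f) n ⟩
  poly (multiples q d) (P (q * d) f) n ∎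
  where open ≡-Reasoning

module _ (N : ℕ) .{{_ : NonZero N}} where

  -- The terms of the progressions within one period N, each progression taken
  -- from its start on.
  residues : List Progression → List ℕ
  residues []               = []
  residues ((a mod d) ∷ ps) = map (a +_) (multiples (N / d) d) ++ residues ps

  Divides : Progression → Set
  Divides (a mod d) = N / d * d ≡ N

  tails-residues : ∀ {ps} f → All Divides ps → tails ps 0 f ≗ poly (residues ps) (P N f)
  tails-residues {[]}           f []         n = refl
  tails-residues {(a mod d) ∷ ps} f (eq ∷ eqs) n = begin
    S (a + 0) (P d f) n + tails ps 0 f n
      ≡⟨ cong₂ _+_ (trans (cong (λ x → S x (P d f) n) (+-identityʳ a))
          (S-cong a (P-multiples (N / d) d f eq) n)) (tails-residues f eqs n) ⟩
    S a (poly (multiples (N / d) d) (P N f)) n + poly (residues ps) (P N f) n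
      ≡⟨ cong (_+ poly (residues ps) (P N f) n) (poly-shift a (multiples (N / d) d) (P N f) n) ⟨
    poly (map (a +_) (multiples (N / d) d)) (P N f) n + poly (residues ps) (P N f) n
      ≡⟨ poly-++ (map (a +_) (multiples (N / d) d)) (residues ps) (P N f) n ⟨
    poly (residues ((a mod d) ∷ ps)) (P N f) n ∎
    where open ≡-Reasoning

  poly-termsBelow : ∀ base {ps k n} f → All Divides ps → n < k →
    poly (termsBelow base ps k) f n ≡ poly (residues ps) (P N f) n + poly base f n
  poly-termsBelow base {ps} {k} {n} f eqs n<k = begin
    poly (termsBelow base ps k) f n                    ≡⟨ +-identityʳ _ ⟨
    poly (termsBelow base ps k) f n + 0
        ≡⟨ cong (poly (termsBelow base ps k) f n +_) (tails-vanish ps f n<k) ⟨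
    poly (termsBelow base ps k) f n + tails ps k f n   ≡⟨ poly-termsBelow-tails base ps k f n ⟩
    tails ps 0 f n + poly base f n
        ≡⟨ cong (_+ poly base f n) (tails-residues f eqs n) ⟩
    poly (residues ps) (P N f) n + poly base f n         ∎
    where open ≡-Reasoning

  -- Once all terms with index at least k exceed n, truncation is harmless, and
  -- everything is a polynomial multiple of w = f / (1 - q^N) with f = regulars t m.
  -- The isolated term q f on the left is replaced by q w after adding q^(N+1) w to
  -- both sides.
  closed-residues : ∀ t {m pos neg k n} → All Divides pos → All Divides neg → n < k →
    Closed t m (termsBelow [] pos k) (termsBelow (1 ∷ []) neg k) →
    hooks t m n + poly (1 ∷ residues neg) (P N (regulars t m)) n ≡
    poly (suc N ∷ residues pos) (P N (regulars t m)) n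
  closed-residues t {m} {pos} {neg} {k} {n} dp dn n<k (closed c) = begin
    h + (S 1 w n + sn)                          ≡⟨ cong (λ z → h + (z + sn)) one ⟩
    h + ((S 1 r n + S (suc N) w n) + sn)        ≡⟨ shuffle h (S 1 r n) (S (suc N) w n) sn ⟩
    S (suc N) w n + (h + (sn + (S 1 r n + 0)))
        ≡⟨ cong (λ z → S (suc N) w n + (h + z)) (poly-termsBelow (1 ∷ []) r dn n<k) ⟨
    S (suc N) w n + (h + poly (termsBelow (1 ∷ []) neg k) r n) ≡⟨ cong (S (suc N) w n +_) (c n) ⟩
    S (suc N) w n + poly (termsBelow [] pos k) r n
        ≡⟨ cong (S (suc N) w n +_) (trans (poly-termsBelow [] r dp n<k) (+-identityʳ _)) ⟩
    S (suc N) w n + poly (residues pos) w n ∎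
    where
    open ≡-Reasoning
    h = hooks t m n
    r = regulars t m
    w = P N r
    sn = poly (residues neg) w n
    one : S 1 w n ≡ S 1 r n + S (suc N) w n
    one = trans (S-cong 1 (P-fix N r) n)
        (trans (S-⊕ 1 r (S N w) n) (cong (S 1 r n +_) (S-S 1 N w n)))
    shuffle : ∀ a b c d → a + ((b + c) + d) ≡ c + (a + (d + (b + 0)))
    shuffle = solve-∀

-- The positive and negative exponents of G_3 and G_4: x and 2x for the residues x
-- of the part sizes, and 2x - 1 for the residues x such that x - 1 is also a
-- residue of a part size.  The exceptional negative exponent 1, from x = 1, is
-- kept apart.  The order is that in which the induction below produces them.
pos₃ neg₃ pos₄ neg₄ : List Progression
pos₃ = 2 mod 3 ∷ 4 mod 6 ∷ 1 mod 3 ∷ 2 mod 6 ∷ []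
neg₃ = 3 mod 6 ∷ []
pos₄ = 3 mod 4 ∷ 6 mod 8 ∷ 2 mod 4 ∷ 4 mod 8 ∷ 1 mod 4 ∷ 2 mod 8 ∷ []
neg₄ = 5 mod 8 ∷ 3 mod 8 ∷ []

closed₃ : ∀ k → Closed 3 (suc k * 3) (termsBelow [] pos₃ (suc k))
    (termsBelow (1 ∷ []) neg₃ (suc k))
closed₃ zero =
  closed-∣ 3 2 {pos = termsBelow [] pos₃ 1} {neg = termsBelow (1 ∷ []) neg₃ 1} (∣-block 3 1)
  (closed-∤ 3 1 (1 ∷ []) (∤-block 2 0 ≤-refl) (regularsBelow-∤ 3 0 (∤-block 1 0 (s≤s (s≤s z≤n))))
  (closed-∤ 3 0 {pos = []} {neg = []} (0 ∷ []) (∤-block 1 0 (s≤s (s≤s z≤n))) (regularsBelow-0 3)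
      (closed-zero 3)))
closed₃ (suc k) = subst₂ (Closed 3 (3 + m))
  (cong₂ (λ a b → 2 + m ∷ a ∷ 1 + m ∷ b ∷ pos) (e₁ (suc k)) (e₂ (suc k)))
  (cong (_∷ neg) (e₃ (suc k)))
  (closed-∣ 3 (2 + m) {pos = 2 + m ∷ (2 + m) + (2 + m) ∷ 1 + m ∷ (1 + m) + (1 + m) ∷ pos}
      {neg = (2 + m) + (1 + m) ∷ neg} (∣-block 3 (suc (suc k)))
  (closed-∤ 3 (1 + m) (1 + m ∷ []) (∤-block 2 (suc k) ≤-refl)
      (regularsBelow-∤ 3 m (∤-block 1 (suc k) (s≤s (s≤s z≤n))))
  (closed-∤ 3 m {pos = pos} {neg = neg} [] (∤-block 1 (suc k) (s≤s (s≤s z≤n)))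
      (regularsBelow-∣ 3 (2 + k * 3) (∣-block 3 (suc k)))
  (closed₃ k))))
  where
  m = suc k * 3
  pos = termsBelow [] pos₃ (suc k)
  neg = termsBelow (1 ∷ []) neg₃ (suc k)
  e₁ : ∀ k → (2 + k * 3) + (2 + k * 3) ≡ 4 + k * 6
  e₁ = solve-∀
  e₂ : ∀ k → (1 + k * 3) + (1 + k * 3) ≡ 2 + k * 6
  e₂ = solve-∀
  e₃ : ∀ k → (2 + k * 3) + (1 + k * 3) ≡ 3 + k * 6
  e₃ = solve-∀

closed₄ : ∀ k → Closed 4 (suc k * 4) (termsBelow [] pos₄ (suc k))
    (termsBelow (1 ∷ []) neg₄ (suc k))
closed₄ zero =
  closed-∣ 4 3 {pos = termsBelow [] pos₄ 1} {neg = termsBelow (1 ∷ []) neg₄ 1} (∣-block 4 1)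
  (closed-∤ 4 2 (2 ∷ []) (∤-block 3 0 ≤-refl)
      (regularsBelow-∤ 4 1 (∤-block 2 0 (s≤s (s≤s (s≤s z≤n)))))
  (closed-∤ 4 1 (1 ∷ []) (∤-block 2 0 (s≤s (s≤s (s≤s z≤n))))
      (regularsBelow-∤ 4 0 (∤-block 1 0 (s≤s (s≤s z≤n))))
  (closed-∤ 4 0 {pos = []} {neg = []} (0 ∷ []) (∤-block 1 0 (s≤s (s≤s z≤n))) (regularsBelow-0 4)
      (closed-zero 4))))
closed₄ (suc k) = subst₂ (Closed 4 (4 + m))
  (cong₂ (λ (a , b) c → 3 + m ∷ a ∷ 2 + m ∷ b ∷ 1 + m ∷ c ∷ pos)
    (cong₂ _,_ (e₁ (suc k)) (e₂ (suc k))) (e₃ (suc k)))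
  (cong₂ (λ a b → a ∷ b ∷ neg) (e₄ (suc k)) (e₅ (suc k)))
  (closed-∣ 4 (3 + m) {pos = 3 + m ∷ (3 + m) + (3 + m) ∷ 2 + m ∷ (2 + m) + (2 + m) ∷ 1 + m ∷
      (1 + m) + (1 + m) ∷ pos}
    {neg = (3 + m) + (2 + m) ∷ (2 + m) + (1 + m) ∷ neg} (∣-block 4 (suc (suc k)))
  (closed-∤ 4 (2 + m) (2 + m ∷ []) (∤-block 3 (suc k) ≤-refl)
      (regularsBelow-∤ 4 (1 + m) (∤-block 2 (suc k) (s≤s (s≤s (s≤s z≤n)))))
  (closed-∤ 4 (1 + m) (1 + m ∷ []) (∤-block 2 (suc k) (s≤s (s≤s (s≤s z≤n))))
      (regularsBelow-∤ 4 m (∤-block 1 (suc k) (s≤s (s≤s z≤n))))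
  (closed-∤ 4 m {pos = pos} {neg = neg} [] (∤-block 1 (suc k) (s≤s (s≤s z≤n)))
      (regularsBelow-∣ 4 (3 + k * 4) (∣-block 4 (suc k)))
  (closed₄ k)))))
  where
  m = suc k * 4
  pos = termsBelow [] pos₄ (suc k)
  neg = termsBelow (1 ∷ []) neg₄ (suc k)
  e₁ : ∀ k → (3 + k * 4) + (3 + k * 4) ≡ 6 + k * 8
  e₁ = solve-∀
  e₂ : ∀ k → (2 + k * 4) + (2 + k * 4) ≡ 4 + k * 8
  e₂ = solve-∀
  e₃ : ∀ k → (1 + k * 4) + (1 + k * 4) ≡ 2 + k * 8
  e₃ = solve-∀
  e₄ : ∀ k → (3 + k * 4) + (2 + k * 4) ≡ 5 + k * 8
  e₄ = solve-∀
  e₅ : ∀ k → (2 + k * 4) + (1 + k * 4) ≡ 3 + k * 8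
  e₅ = solve-∀

-- Comparison of the two polynomials

Nondecreasing : Seq → Set
Nondecreasing f = S 1 f ≼ f

S-≼ : ∀ x {f} → Nondecreasing f → S x f ≼ f
S-≼ zero    inc n = ≤-refl
S-≼ (suc x) {f} inc n = begin
  S (suc x) f n     ≡⟨ S-S 1 x f n ⟨
  S 1 (S x f) n     ≤⟨ S-mono 1 (S-≼ x inc) n ⟩
  S 1 f n           ≤⟨ inc n ⟩
  f n               ∎
  where open ≤-Reasoning

S-antitone : ∀ {x y f} → Nondecreasing f → x ≤ y → S y f ≼ S x f
S-antitone {x} {y} {f} inc x≤y n = begin
  S y f n               ≡⟨ cong (λ z → S z f n) (m+[n∸m]≡n x≤y) ⟨
  S (x + (y ∸ x)) f n   ≡⟨ S-S x (y ∸ x) f n ⟨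
  S x (S (y ∸ x) f) n   ≤⟨ S-mono x (S-≼ (y ∸ x) inc) n ⟩
  S x f n               ∎
  where open ≤-Reasoning

poly-antitone : ∀ {xs ys f} → Nondecreasing f → Pointwise _≤_ xs ys → poly ys f ≼ poly xs f
poly-antitone inc []       n = ≤-refl
poly-antitone inc (p ∷ ps) n = +-mono-≤ (S-antitone inc p n) (poly-antitone inc ps n)

-- f is a multiple of 1 / ((1 - q)(1 - q^2)).
Divisible : Seq → Set
Divisible f = ∃ λ g → f ≗ P 1 (P 2 g)

divisible-P : ∀ x .{{_ : NonZero x}} {f} → Divisible f → Divisible (P x f)
divisible-P x {f} (g , eq) = P x g , λ n → begin
  P x f n                 ≡⟨ P-cong x eq n ⟩
  P x (P 1 (P 2 g)) n     ≡⟨ P-P x 1 (P 2 g) n ⟩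
  P 1 (P x (P 2 g)) n     ≡⟨ P-cong 1 (P-P x 2 g) n ⟩
  P 1 (P 2 (P x g)) n     ∎
  where open ≡-Reasoning

divisible-regulars : ∀ t m → 2 < t → Divisible (regulars t (2 + m))
divisible-regulars t zero 2<t = regulars t 0 , λ n → begin
  regulars t 2 n                 ≡⟨ regulars-P t 1 (>⇒∤ 2<t) n ⟩
  P 2 (regulars t 1) n           ≡⟨ P-cong 2 (regulars-P t 0 (>⇒∤ (<-trans (n<1+n 1) 2<t))) n ⟩
  P 2 (P 1 (regulars t 0)) n     ≡⟨ P-P 2 1 (regulars t 0) n ⟩
  P 1 (P 2 (regulars t 0)) n     ∎
  where open ≡-Reasoning
divisible-regulars t (suc m) 2<t with t ∣? (3 + m) | divisible-regulars t m 2<t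
... | yes t∣ | g , eq = g , λ n → trans (total-∣ t (const 1) (2 + m) t∣ n) (eq n)
... | no  t∤ | d with g , eq ← divisible-P (3 + m) d = g , λ n → trans (regulars-P t (2 + m) t∤ n)
    (eq n)

divisible-nondecreasing : ∀ {f} → Divisible f → Nondecreasing f
divisible-nondecreasing {f} (g , eq) n = begin
  S 1 f n                                   ≡⟨ S-cong 1 eq n ⟩
  S 1 (P 1 (P 2 g)) n                       ≤⟨ m≤n+m _ (P 2 g n) ⟩
  P 2 g n + S 1 (P 1 (P 2 g)) n             ≡⟨ P-fix 1 (P 2 g) n ⟨
  P 1 (P 2 g) n                             ≡⟨ eq n ⟨
  f n                                       ∎
  where open ≤-Reasoning

-- (1 - q)(1 - q^2) f = (1 - q - q^2 + q^3) f is nonnegative.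
divisible-exchange : ∀ {f} → Divisible f → poly (1 ∷ 2 ∷ []) f ≼ poly (0 ∷ 3 ∷ []) f
divisible-exchange {f} (g , eq) n = begin
  S 1 f n + (S 2 f n + 0)              ≡⟨ cong (λ z → S 1 f n + (z + 0)) (f-shift 2 n) ⟩
  S 1 f n + ((S 2 u n + S 3 f n) + 0)
      ≤⟨ +-monoʳ-≤ (S 1 f n) (+-monoˡ-≤ 0 (+-monoˡ-≤ (S 3 f n) u-inc)) ⟩
  S 1 f n + ((u n + S 3 f n) + 0)      ≡⟨ shuffle (S 1 f n) (u n) (S 3 f n) ⟩
  (u n + S 1 f n) + (S 3 f n + 0)      ≡⟨ cong (_+ (S 3 f n + 0)) (f-shift 0 n) ⟨
  f n + (S 3 f n + 0)                  ∎
  where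
  open ≤-Reasoning
  u = P 2 g
  f-fix : f ≗ u ⊕ S 1 f
  f-fix n = trans (eq n) (trans (P-fix 1 u n) (cong (u n +_) (S-cong 1 (λ k → sym (eq k)) n)))
  f-shift : ∀ x → S x f ≗ S x u ⊕ S (x + 1) f
  f-shift x n = trans (S-cong x f-fix n)
      (trans (S-⊕ x u (S 1 f) n) (cong (S x u n +_) (S-S x 1 f n)))
  u-inc : S 2 u n ≤ u n
  u-inc = ≤-trans (m≤n+m _ (g n)) (≤-reflexive (sym (P-fix 2 g n)))
  shuffle : ∀ a b c → a + ((b + c) + 0) ≡ (b + a) + (c + 0)
  shuffle = solve-∀

exchange : ∀ x es {f} → Divisible f →
           poly (x + 1 ∷ x + 2 ∷ es) f ≼ poly (x + 0 ∷ x + 3 ∷ es) f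
exchange x es {f} d n = begin
  poly (x + 1 ∷ x + 2 ∷ es) f n                      ≡⟨ poly-++ (map (x +_) (1 ∷ 2 ∷ [])) es f n ⟩
  poly (map (x +_) (1 ∷ 2 ∷ [])) f n + poly es f n
      ≡⟨ cong (_+ poly es f n) (poly-shift x (1 ∷ 2 ∷ []) f n) ⟩
  S x (poly (1 ∷ 2 ∷ []) f) n + poly es f n
      ≤⟨ +-monoˡ-≤ (poly es f n) (S-mono x (divisible-exchange d) n) ⟩
  S x (poly (0 ∷ 3 ∷ []) f) n + poly es f n
      ≡⟨ cong (_+ poly es f n) (poly-shift x (0 ∷ 3 ∷ []) f n) ⟨
  poly (map (x +_) (0 ∷ 3 ∷ [])) f n + poly es f n
      ≡⟨ poly-++ (map (x +_) (0 ∷ 3 ∷ [])) es f n ⟨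
  poly (x + 0 ∷ x + 3 ∷ es) f n                      ∎
  where open ≤-Reasoning

-- The polynomial g such that the hooks of length 2 in 4-regular partitions have
-- generating function g W_4: the negative terms cancel completely.
gain₄ : List ℕ
gain₄ = 2 ∷ 2 ∷ 4 ∷ 6 ∷ 6 ∷ 7 ∷ 9 ∷ 10 ∷ 10 ∷ 12 ∷ 14 ∷ 14 ∷ 15 ∷ 17 ∷ 18 ∷ 18 ∷ 20 ∷ 22 ∷ 22
    ∷ 23 ∷ 25 ∷ []

-- The polynomials l and r for 3-regular partitions, with the terms q and q^25 of
-- closed-residues.
lhs₃ rhs₃ : List ℕ
lhs₃ = 1 ∷ residues 24 neg₃
rhs₃ = 25 ∷ residues 24 pos₃

-- The coefficients of f are nondecreasing, so lowering exponents of rhs₃ does not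
-- decrease the product with f; by exchange, neither does trading 4, 5 for 3, 6
-- and 7, 8 for 6, 9.  This leads to gain₄ ++ lhs₃ without one exponent 21.
gain-dominates : ∀ {f} → Divisible f → poly rhs₃ f ≼ poly (gain₄ ++ lhs₃) f
gain-dominates {f} d n = begin
  poly rhs₃ f n                                ≡⟨ poly-sort rhs₃ (sort rhs₃) f refl n ⟩
  poly (sort rhs₃) f n
      ≤⟨ poly-antitone (divisible-nondecreasing d)
          (from-yes (Pointwise.decidable _≤?_ (sort (4 ∷ 5 ∷ 7 ∷ 8 ∷ common)) (sort rhs₃))) n ⟩
  poly (sort (4 ∷ 5 ∷ 7 ∷ 8 ∷ common)) f n
      ≡⟨ poly-sort (sort (4 ∷ 5 ∷ 7 ∷ 8 ∷ common)) (4 ∷ 5 ∷ 7 ∷ 8 ∷ common) f refl n ⟩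
  poly (4 ∷ 5 ∷ 7 ∷ 8 ∷ common) f n            ≤⟨ exchange 3 (7 ∷ 8 ∷ common) d n ⟩
  poly (3 ∷ 6 ∷ 7 ∷ 8 ∷ common) f n
      ≡⟨ poly-sort (3 ∷ 6 ∷ 7 ∷ 8 ∷ common) (7 ∷ 8 ∷ 3 ∷ 6 ∷ common) f refl n ⟩
  poly (7 ∷ 8 ∷ 3 ∷ 6 ∷ common) f n            ≤⟨ exchange 6 (3 ∷ 6 ∷ common) d n ⟩
  poly (6 ∷ 9 ∷ 3 ∷ 6 ∷ common) f n            ≤⟨ m≤n+m _ (S 21 f n) ⟩
  poly (21 ∷ 6 ∷ 9 ∷ 3 ∷ 6 ∷ common) f n
      ≡⟨ poly-sort (21 ∷ 6 ∷ 9 ∷ 3 ∷ 6 ∷ common) (gain₄ ++ lhs₃) f refl n ⟩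
  poly (gain₄ ++ lhs₃) f n                     ∎
  where
  open ≤-Reasoning
  common : List ℕ
  common = 1 ∷ 2 ∷ 2 ∷ 4 ∷ 7 ∷ 9 ∷ 10 ∷ 10 ∷ 12 ∷ 14 ∷ 14 ∷ 15 ∷ 15 ∷ 17 ∷ 18 ∷ 18 ∷ 20 ∷ 22 ∷ 22
      ∷ 23 ∷ 25 ∷ []

theorem1p2 : (n : ℕ) → b 4 2 n ≥ b 3 2 n
theorem1p2 n = begin
  hooks 3 n n              ≡⟨ total-stable 3 (hookCount 2) n≤m₃ ⟨
  hooks 3 m₃ n             ≤⟨ +-cancelʳ-≤ (poly lhs₃ w₃ n) _ _ (begin
      hooks 3 m₃ n + poly lhs₃ w₃ n
          ≡⟨ closed-residues 24 3 {pos = pos₃} {neg₃} (refl ∷ refl ∷ refl ∷ refl ∷ []) (refl ∷ [])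
              (n<1+n n) (closed₃ n) ⟩
      poly rhs₃ w₃ n
          ≤⟨ gain-dominates (divisible-P 24 (divisible-regulars 3 (1 + n * 3) ≤-refl)) n ⟩
      poly (gain₄ ++ lhs₃) w₃ n          ≡⟨ poly-++ gain₄ lhs₃ w₃ n ⟩
      poly gain₄ w₃ n + poly lhs₃ w₃ n     ∎) ⟩
  poly gain₄ w₃ n        ≤⟨ poly-mono≤ gain₄ n w₃≤w₄ ≤-refl ⟩
  poly gain₄ w₄ n        ≡⟨ H₄ ⟨
  hooks 4 m₄ n             ≡⟨ total-stable 4 (hookCount 2) n≤m₄ ⟩
  hooks 4 n n              ∎
  where
  open ≤-Reasoning
  -- Whole periods that reach beyond n.
  m₃ = suc n * 3
  m₄ = suc n * 4
  w₃ = P 24 (regulars 3 m₃)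
  w₄ = P 24 (regulars 4 m₄)
  n≤m₃ : n ≤ m₃
  n≤m₃ = ≤-trans (n≤1+n n) (m≤m*n (suc n) 3)
  n≤m₄ : n ≤ m₄
  n≤m₄ = ≤-trans (n≤1+n n) (m≤m*n (suc n) 4)
  -- By definition, the coefficient of P 24 f at k is that of M (suc k) 24 f.
  w₃≤w₄ : ∀ {k} → k ≤ n → w₃ k ≤ w₄ k
  w₃≤w₄ {k} k≤n = M-mono≤ (suc k) 24 n
    (λ j≤n → regulars-mono 3 m₃ m₄ (≤-trans j≤n n≤m₃) (≤-trans j≤n n≤m₄)) k≤n
  lhs₄ = 1 ∷ residues 24 neg₄
  H₄ : hooks 4 m₄ n ≡ poly gain₄ w₄ n
  H₄ = +-cancelʳ-≡ (poly lhs₄ w₄ n) _ _ (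
    trans (closed-residues 24 4 {pos = pos₄} {neg₄} (refl ∷ refl ∷ refl ∷ refl ∷ refl ∷ refl ∷ [])
        (refl ∷ refl ∷ []) (n<1+n n) (closed₄ n))
    (trans (poly-sort (25 ∷ residues 24 pos₄) (gain₄ ++ lhs₄) w₄ refl n)
        (poly-++ gain₄ lhs₄ w₄ n)))
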